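{- Let $n\ge 1$, let $S\subseteq\mathbb{Z}_n\setminus\{0\}$, and let $\Gamma=\mathrm{Circ}(n,S)$ be connected and arc-transitive. Then $\Gamma$ is normal-arc-transitive (that is, $\mathrm{Aut}(\mathbb{Z}_n,S)$ is transitive on $S$) if and only if every element of $S$ has order $n$ in $\mathbb{Z}_n$.
   Context: For $S\subseteq\mathbb{Z}_n\setminus\{0\}$, the circulant (Cayley digraph) $\mathrm{Circ}(n,S)=\mathrm{Cay}(\mathbb{Z}_n,S)$ has vertex set $\mathbb{Z}_n$, with an arc from $v$ to $w$ iff $w-v\in S$. A digraph is arc-transitive if its automorphism group acts transitively on its set of arcs (ordered pairs $(v,w)$ with an arc from $v$ to $w$). It is connected if its underlying undirected graph is connected (for $\mathrm{Circ}(n,S)$ this means $\langle S\rangle=\mathbb{Z}_n$). $\mathrm{Aut}(\mathbb{Z}_n,S)=\{\sigma\in\mathrm{Aut}(\mathbb{Z}_n):\sigma(S)=S\}$. The circulant $\mathrm{Circ}(n,S)$ is called normal-arc-transitive if $\mathrm{Aut}(\mathbb{Z}_n,S)$ acts transitively on $S$. -}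

module Defs where

open import Data.Nat using (ℕ; suc; _+_; _*_; _∸_; _≤_; _<_; NonZero)
open import Data.Nat.DivMod using (_mod_)
open import Data.Fin using (Fin; toℕ; zero)
open import Data.Fin.Subset using (Subset; _∈_)
open import Data.Fin.Permutation using (Permutation′; _⟨$⟩ʳ_)
open import Data.Product using (Σ; _×_; _,_)
open import Data.Sum using (_⊎_)
open import Function.Bundles using (_⇔_)
open import Relation.Binary.PropositionalEquality using (_≡_)

-- The cyclic group ℤ_n, represented by Fin n (residues 0 … n-1), n ≥ 1.
module _ {n : ℕ} .{{_ : NonZero n}} where

  𝟘 : Fin n
  𝟘 = 0 mod n

  _⊕_ : Fin n → Fin n → Fin n
  a ⊕ b = (toℕ a + toℕ b) mod n

  _⊖_ : Fin n → Fin n → Fin n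
  a ⊖ b = (toℕ a + (n ∸ toℕ b)) mod n

  _·_ : ℕ → Fin n → Fin n
  k · a = (k * toℕ a) mod n

  HasOrder : Fin n → ℕ → Set
  HasOrder a d = (0 < d) × (d · a ≡ 𝟘)
               × (∀ k → 0 < k → k · a ≡ 𝟘 → d ≤ k)

  Arc : Subset n → Fin n → Fin n → Set
  Arc S v w = (w ⊖ v) ∈ S

  IsDigraphAut : Subset n → Permutation′ n → Set
  IsDigraphAut S π = ∀ v w → Arc S v w ⇔ Arc S (π ⟨$⟩ʳ v) (π ⟨$⟩ʳ w)

  ArcTransitive : Subset n → Set
  ArcTransitive S =
    ∀ v w v′ w′ → Arc S v w → Arc S v′ w′ →
    Σ (Permutation′ n) λ π → IsDigraphAut S π
      × (π ⟨$⟩ʳ v ≡ v′) × (π ⟨$⟩ʳ w ≡ w′)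

  data Reach (S : Subset n) (v : Fin n) : Fin n → Set where
    here : Reach S v v
    fwd  : ∀ {u w} → Reach S v u → Arc S u w → Reach S v w
    bwd  : ∀ {u w} → Reach S v u → Arc S w u → Reach S v w

  Connected : Subset n → Set
  Connected S = ∀ v w → Reach S v w

  IsGroupAut : Permutation′ n → Set
  IsGroupAut σ = ∀ a b → σ ⟨$⟩ʳ (a ⊕ b) ≡ (σ ⟨$⟩ʳ a) ⊕ (σ ⟨$⟩ʳ b)

  InAutZnS : Subset n → Permutation′ n → Set
  InAutZnS S σ = IsGroupAut σ × (∀ x → x ∈ S ⇔ (σ ⟨$⟩ʳ x) ∈ S)

  NormalArcTransitive : Subset n → Set
  NormalArcTransitive S =
    ∀ s t → s ∈ S → t ∈ S →
    Σ (Permutation′ n) λ σ → InAutZnS S σ × (σ ⟨$⟩ʳ s ≡ t)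

{-# OPTIONS --safe #-}
module Submission where

-- Generators from normality: if k annihilates one s ∈ S then, Aut(ℤ_n, S) being
-- transitive on S, it annihilates S and hence, by connectedness, all of ℤ_n.
--
-- Normality from generators is Schur's theorem on multipliers. Let φ be a digraph
-- automorphism, and let A_T be the operator f ↦ Σ_{s ∈ T} f(· + s) on functions on ℤ_n.
-- A_T is a sum of commuting translations, so by Frobenius A_T^p ≡ A_{pT} modulo every
-- prime p. If φ preserves Circ(n, T) then it commutes with A_T, thus with A_{pT} mod p;
-- for p ∤ n the entries of A_{pT} are 0 or 1, so φ preserves Circ(n, pT) as well.
-- Running over prime factors, φ preserves Circ(n, mS) for every unit m. If s, t ∈ S are
-- generators with t = m s, then mS contains t, and the stabiliser of 0 preserves mS and is
-- transitive on S; so S ⊆ mS, and symmetrically mS ⊆ S.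

open import Defs
open import Algebra.Bundles using (CommutativeMonoid; Semiring)
import Algebra.Construct.Pointwise as Pointwise
import Algebra.Properties.CommutativeMonoid.Sum as CommutativeMonoidSum
import Algebra.Properties.Semiring.Binomial as Binomial
import Algebra.Properties.Semiring.Exp as Exp
import Algebra.Properties.Semiring.Mult as Mult
import Algebra.Properties.Semiring.Sum as SemiringSum
open import Data.Bool using (Bool; true; false; if_then_else_)
open import Data.Fin using (Fin; zero; suc; toℕ; fromℕ; inject₁)
open import Data.Fin.Permutation using (Permutation′; permutation; _⟨$⟩ʳ_; _⟨$⟩ˡ_; inverseˡ)
open import Data.Fin.Properties using (toℕ-fromℕ; toℕ-inject₁; toℕ<n; punchInᵢ≢i; _≟_; toℕ-fromℕ<; fromℕ<-cong; fromℕ<-toℕ)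
open import Data.Fin.Subset using (Subset; _∈_; _∉_)
open import Data.List using ([]; _∷_)
open import Data.List.Relation.Unary.All using (All; []; _∷_)
open import Data.Nat as ℕ using (ℕ; zero; suc; _+_; _*_; _∸_; _≤_; _<_; s≤s; NonZero)
open import Data.Nat.Combinatorics using (_C_; nC1≡n; nCn≡1; nCk+nC[k+1]≡[n+1]C[k+1])
open import Data.Nat.Divisibility using (_∣_; divides; ∣⇒≤; m∣m*n; m%n≡0⇒n∣m)
open import Data.Nat.Coprimality using (Coprime; coprime-Bézout)
open import Data.Nat.DivMod using (_%_; _mod_; m%n%n≡m%n; m%n<n; m<n⇒m%n≡m; m*n%n≡0; [m+n]%n≡m%n; [m+kn]%n≡m%n; %-distribˡ-+; %-distribˡ-*)
open import Data.Nat.GCD using (module Bézout)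
open import Data.Nat.ListAction using (product)
open import Data.Nat.Primality using (Prime; euclidsLemma; prime⇒nonZero; prime⇒nonTrivial)
open import Data.Nat.Primality.Factorisation using (PrimeFactorisation; factorise)
import Data.Nat.Properties as ℕ
open import Data.Nat.Tactic.RingSolver using (solve-∀)
open import Data.Product using (∃; _,_)
open import Data.Sum using (inj₁; inj₂)
open import Data.Vec using (lookup)
open import Data.Vec.Properties using ([]=⇒lookup; lookup⇒[]=)
open import Data.Vec.Functional using (removeAt; replicate)
open import Function using (_∘_; id)
open import Function.Bundles using (_⇔_; mk⇔; Equivalence)
open import Level using (Level; _⊔_; 0ℓ)
import Relation.Binary.Construct.On as On
import Relation.Binary.Reasoning.Setoid as SetoidReasoning
open import Relation.Binary.PropositionalEquality as ≡ using (_≡_; _≢_; refl; cong; cong₂; subst; module ≡-Reasoning)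
open import Relation.Nullary using (does; contradiction)
open import Relation.Nullary.Decidable using (dec-true; dec-false)

private
  variable
    c ℓ : Level

-- Divisibility of binomial coefficients by a prime.

-- Absorption identity, from Pascal's rule by induction on `n`; the product form avoids division.
[1+k]*[1+n]C[1+k]≡[1+n]*nCk : ∀ n k → suc k * (suc n C suc k) ≡ suc n * (n C k)
[1+k]*[1+n]C[1+k]≡[1+n]*nCk n       zero    = ≡.trans (ℕ.+-identityʳ _) (≡.trans (nC1≡n (suc n)) (≡.sym (ℕ.*-identityʳ (suc n))))
[1+k]*[1+n]C[1+k]≡[1+n]*nCk zero    (suc k) = ℕ.*-zeroʳ k
[1+k]*[1+n]C[1+k]≡[1+n]*nCk (suc n) (suc k) = begin
  suc (suc k) * (suc (suc n) C suc (suc k))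
    ≡⟨ cong (suc (suc k) *_) (nCk+nC[k+1]≡[n+1]C[k+1] (suc n) (suc k)) ⟨
  suc (suc k) * (a + (suc n C suc (suc k)))
    ≡⟨ ℕ.*-distribˡ-+ (suc (suc k)) a _ ⟩
  a + suc k * a + suc (suc k) * (suc n C suc (suc k))
    ≡⟨ cong₂ (λ u v → a + u + v) ([1+k]*[1+n]C[1+k]≡[1+n]*nCk n k) ([1+k]*[1+n]C[1+k]≡[1+n]*nCk n (suc k)) ⟩
  a + suc n * (n C k) + suc n * (n C suc k)
    ≡⟨ ℕ.+-assoc a _ _ ⟩
  a + (suc n * (n C k) + suc n * (n C suc k))
    ≡⟨ cong (a +_) (ℕ.*-distribˡ-+ (suc n) (n C k) (n C suc k)) ⟨
  a + suc n * (n C k + n C suc k)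
    ≡⟨ cong (λ u → a + suc n * u) (nCk+nC[k+1]≡[n+1]C[k+1] n k) ⟩
  suc (suc n) * a ∎
  where
  open ≡-Reasoning
  a = suc n C suc k

-- By absorption the prime divides the product of `suc k` and the coefficient, and it is too large
-- to divide `suc k`.
prime∣pCk : ∀ {q k} → Prime (suc q) → k < q → suc q ∣ suc q C suc k
prime∣pCk {q} {k} pr k<q
  with euclidsLemma (suc k) (suc q C suc k) pr
         (subst (suc q ∣_) (≡.sym ([1+k]*[1+n]C[1+k]≡[1+n]*nCk q k)) (m∣m*n (q C k)))
... | inj₁ p∣k = contradiction (∣⇒≤ p∣k) (ℕ.<⇒≱ (s≤s k<q))
... | inj₂ p∣C = p∣C

-- The Frobenius map on commuting elements of a semiring of characteristic p.

module Frobenius (R : Semiring c ℓ) (p : ℕ) (p-prime : Prime p) where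

  open Semiring R hiding (zero)
    renaming (_+_ to _⊞_; _*_ to _⊠_; refl to ≈-refl; sym to ≈-sym; trans to ≈-trans)
  open SemiringSum R
  open Mult R using (×-assocˡ) renaming (_×_ to _×ₙ_)
  open Exp R
  open SetoidReasoning setoid

  0^≈0 : ∀ k .{{_ : NonZero k}} → 0# ^ k ≈ 0#
  0^≈0 (suc k) = zeroˡ _

  module _ (char : ∀ x → p ×ₙ x ≈ 0#) where

    ∣⇒×≈0 : ∀ {k} → p ∣ k → ∀ x → k ×ₙ x ≈ 0#
    ∣⇒×≈0 {k} (divides q k≡q*p) x = begin
      k ×ₙ x         ≡⟨ cong (_×ₙ x) (≡.trans k≡q*p (ℕ.*-comm q p)) ⟩
      (p * q) ×ₙ x   ≈⟨ ×-assocˡ x p q ⟨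
      p ×ₙ (q ×ₙ x)  ≈⟨ char _ ⟩
      0#             ∎

    sum≈0 : ∀ {m} (xs : Fin m → Carrier) → (∀ i → xs i ≈ 0#) → sum xs ≈ 0#
    sum≈0 {m} xs xs≈0 = ≈-trans (sum-cong-≋ xs≈0) (sum-replicate-zero m)

    -- All inner terms of the binomial expansion have coefficients divisible by `p`. The semiring
    -- need not be commutative, so the expansion relies on x and y commuting.
    ^-distrib-+ : ∀ {x y} → x ⊠ y ≈ y ⊠ x → (x ⊞ y) ^ p ≈ x ^ p ⊞ y ^ p
    ^-distrib-+ {x} {y} xy≈yx = go p p-prime refl
      where
      open Binomial R x y
      -- `p` is a module parameter, so a variable `r` equal to it is split into `suc q`, which
      -- separates the two end terms of the expansion.
      go : ∀ r → Prime r → r ≡ p → (x ⊞ y) ^ r ≈ x ^ r ⊞ y ^ r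
      go zero    r-prime r≡p = contradiction refl (ℕ.≢-nonZero⁻¹ 0 {{prime⇒nonZero r-prime}})
      go (suc q) r-prime refl = begin
        (x ⊞ y) ^ suc q                                ≈⟨ theorem xy≈yx (suc q) ⟩
        term zero ⊞ sum (term ∘ suc)                   ≈⟨ +-congˡ (sum-init-last (term ∘ suc)) ⟩
        term zero ⊞ (sum (term ∘ suc ∘ inject₁) ⊞ term (suc (fromℕ q)))
                                                       ≈⟨ +-congˡ (+-congʳ (sum≈0 _ middle)) ⟩
        term zero ⊞ (0# ⊞ term (suc (fromℕ q)))        ≈⟨ +-cong first (≈-trans (+-identityˡ _) last′) ⟩
        y ^ suc q ⊞ x ^ suc q                          ≈⟨ +-comm _ _ ⟩
        x ^ suc q ⊞ y ^ suc q                          ∎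
        where
        term = binomialTerm (suc q)
        first : term zero ≈ y ^ suc q
        first = ≈-trans (+-identityʳ _) (*-identityˡ _)
        -- The index runs from 1 to `q`, strictly between 0 and the prime.
        middle : ∀ i → term (suc (inject₁ i)) ≈ 0#
        middle i = ∣⇒×≈0 (subst (λ k → suc q ∣ suc q C suc k) (≡.sym (toℕ-inject₁ i)) (prime∣pCk r-prime (toℕ<n i))) _
        last′ : term (suc (fromℕ q)) ≈ x ^ suc q
        last′ rewrite toℕ-fromℕ q | nCn≡1 (suc q) | ℕ.n∸n≡0 q = ≈-trans (+-identityʳ _) (*-identityʳ _)

    sum-^ : ∀ {m} (xs : Fin m → Carrier) → (∀ i j → xs i ⊠ xs j ≈ xs j ⊠ xs i) →
            sum xs ^ p ≈ sum (λ i → xs i ^ p)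
    -- The empty sum is 0, and its p-th power vanishes because a prime is nonzero.
    sum-^ {zero}  xs comm = 0^≈0 p {{prime⇒nonZero p-prime}}
    sum-^ {suc m} xs comm = ≈-trans (^-distrib-+ x₀-comm) (+-congˡ (sum-^ (xs ∘ suc) (λ i j → comm (suc i) (suc j))))
      where
      x₀-comm : xs zero ⊠ sum (xs ∘ suc) ≈ sum (xs ∘ suc) ⊠ xs zero
      x₀-comm = begin
        xs zero ⊠ sum (xs ∘ suc)            ≈⟨ *-distribˡ-sum _ (xs ∘ suc) ⟩
        sum (λ i → xs zero ⊠ xs (suc i))    ≈⟨ sum-cong-≋ (λ i → comm zero (suc i)) ⟩
        sum (λ i → xs (suc i) ⊠ xs zero)    ≈⟨ *-distribʳ-sum _ (xs ∘ suc) ⟨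
        sum (xs ∘ suc) ⊠ xs zero            ∎

  ^-comm : ∀ {x y} → x ⊠ y ≈ y ⊠ x → ∀ k → x ⊠ y ^ k ≈ y ^ k ⊠ x
  ^-comm {x} {y} xy≈yx zero    = ≈-trans (*-identityʳ x) (≈-sym (*-identityˡ x))
  ^-comm {x} {y} xy≈yx (suc k) = begin
    x ⊠ (y ⊠ y ^ k)  ≈⟨ *-assoc x y _ ⟨
    x ⊠ y ⊠ y ^ k    ≈⟨ *-congʳ xy≈yx ⟩
    y ⊠ x ⊠ y ^ k    ≈⟨ *-assoc y x _ ⟩
    y ⊠ (x ⊠ y ^ k)  ≈⟨ *-congˡ (^-comm xy≈yx k) ⟩
    y ⊠ (y ^ k ⊠ x)  ≈⟨ *-assoc y _ x ⟨
    y ⊠ y ^ k ⊠ x    ∎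

-- The semiring of additive operators on a commutative monoid.

module Endomorphism (M : CommutativeMonoid c ℓ) where

  open CommutativeMonoid M renaming (refl to ≈-refl)

  -- Operators take the place of matrices: with composition as product, associativity is immediate.
  -- `∙-homo` supplies left distributivity, and `ε-homo` supplies a · 0 = 0, which additivity alone
  -- does not give without cancellation.
  record Endo : Set (c ⊔ ℓ) where
    field
      ⟦_⟧     : Carrier → Carrier
      ⟦⟧-cong : ∀ {x y} → x ≈ y → ⟦_⟧ x ≈ ⟦_⟧ y
      ∙-homo  : ∀ x y → ⟦_⟧ (x ∙ y) ≈ ⟦_⟧ x ∙ ⟦_⟧ y
      ε-homo  : ⟦_⟧ ε ≈ ε

  open Endo public

  infixl 6 _⊞_
  infixl 7 _⊠_

  _⊞_ _⊠_ : Endo → Endo → Endo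
  a ⊞ b = record
    { ⟦_⟧     = λ x → ⟦ a ⟧ x ∙ ⟦ b ⟧ x
    ; ⟦⟧-cong = λ x≈y → ∙-cong (⟦⟧-cong a x≈y) (⟦⟧-cong b x≈y)
    ; ∙-homo  = λ x y → trans (∙-cong (∙-homo a x y) (∙-homo b x y)) (interchange _ _ _ _)
    ; ε-homo  = trans (∙-cong (ε-homo a) (ε-homo b)) (identityˡ ε)
    }
    where open import Algebra.Properties.CommutativeSemigroup commutativeSemigroup using (interchange)
  a ⊠ b = record
    { ⟦_⟧     = λ x → ⟦ a ⟧ (⟦ b ⟧ x)
    ; ⟦⟧-cong = λ x≈y → ⟦⟧-cong a (⟦⟧-cong b x≈y)
    ; ∙-homo  = λ x y → trans (⟦⟧-cong a (∙-homo b x y)) (∙-homo a _ _)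
    ; ε-homo  = trans (⟦⟧-cong a (ε-homo b)) (ε-homo a)
    }

  0ₑ 1ₑ : Endo
  0ₑ = record { ⟦_⟧ = λ _ → ε ; ⟦⟧-cong = λ _ → ≈-refl ; ∙-homo = λ _ _ → sym (identityˡ ε) ; ε-homo = ≈-refl }
  1ₑ = record { ⟦_⟧ = id ; ⟦⟧-cong = id ; ∙-homo = λ _ _ → ≈-refl ; ε-homo = ≈-refl }

  semiring : Semiring (c ⊔ ℓ) (c ⊔ ℓ)
  semiring = record
    { Carrier    = Endo
    ; _≈_        = λ a b → ∀ x → ⟦ a ⟧ x ≈ ⟦ b ⟧ x
    ; _+_        = _⊞_
    ; _*_        = _⊠_
    ; 0#         = 0ₑ
    ; 1#         = 1ₑ
    ; isSemiring = record
      { isSemiringWithoutAnnihilatingZero = record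
        { +-isCommutativeMonoid = record
          { isMonoid = record
            { isSemigroup = record
              { isMagma = record
                { isEquivalence = record
                  { refl  = λ _ → ≈-refl
                  ; sym   = λ a≈b x → sym (a≈b x)
                  ; trans = λ a≈b b≈c x → trans (a≈b x) (b≈c x)
                  }
                ; ∙-cong = λ a≈b c≈d x → ∙-cong (a≈b x) (c≈d x)
                }
              ; assoc = λ _ _ _ _ → assoc _ _ _
              }
            ; identity = (λ _ _ → identityˡ _) , (λ _ _ → identityʳ _)
            }
          ; comm = λ _ _ _ → comm _ _
          }
        ; *-cong     = λ {a} a≈b c≈d x → trans (⟦⟧-cong a (c≈d x)) (a≈b _)
        ; *-assoc    = λ _ _ _ _ → ≈-refl
        ; *-identity = (λ _ _ → ≈-refl) , (λ _ _ → ≈-refl)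
        ; distrib    = (λ a _ _ _ → ∙-homo a _ _) , (λ _ _ _ _ → ≈-refl)
        }
      ; zero = (λ _ _ → ≈-refl) , (λ a _ → ε-homo a)
      }
    }

-- Residues are natural numbers under congruence, so 0 and 1 serve as matrix entries without a
-- quotient. Operators act additively, hence only addition is recorded.
ℕ-mod : (p : ℕ) .{{_ : NonZero p}} → CommutativeMonoid 0ℓ 0ℓ
ℕ-mod p = record
  { Carrier = ℕ
  ; _≈_     = λ a b → a % p ≡ b % p
  ; _∙_     = _+_
  ; ε       = 0
  ; isCommutativeMonoid = record
    { isMonoid = record
      { isSemigroup = record
        { isMagma = record
          { isEquivalence = On.isEquivalence (_% p) ≡.isEquivalence
          ; ∙-cong = λ {a} {b} {c} {d} a≈b c≈d →
              ≡.trans (%-distribˡ-+ a c p) (≡.trans (cong₂ (λ u v → (u + v) % p) a≈b c≈d) (≡.sym (%-distribˡ-+ b d p)))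
          }
        ; assoc = λ a b c → cong (_% p) (ℕ.+-assoc a b c)
        }
      ; identity = (λ _ → refl) , (λ a → cong (_% p) (ℕ.+-identityʳ a))
      }
    ; comm = λ a b → cong (_% p) (ℕ.+-comm a b)
    }
  }

-- Arithmetic of ℤ_n: addition, integer multiples and units.

module _ {n : ℕ} .{{_ : NonZero n}} where

  mod-cong : ∀ {a b} → a % n ≡ b % n → a mod n ≡ b mod n
  mod-cong {a} {b} eq = fromℕ<-cong _ _ eq (m%n<n a n) (m%n<n b n)

  toℕ-mod : ∀ a → toℕ (a mod n) ≡ a % n
  toℕ-mod a = toℕ-fromℕ< (m%n<n a n)

  toℕ-mod-% : ∀ a → toℕ (a mod n) % n ≡ a % n
  toℕ-mod-% a = ≡.trans (cong (_% n) (toℕ-mod a)) (m%n%n≡m%n a n)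

  mod-injective : ∀ {a b} → a mod n ≡ b mod n → a % n ≡ b % n
  mod-injective {a} {b} eq = ≡.trans (≡.sym (toℕ-mod a)) (≡.trans (cong toℕ eq) (toℕ-mod b))

  mod-toℕ : ∀ (a : Fin n) → toℕ a mod n ≡ a
  mod-toℕ a = ≡.trans (fromℕ<-cong _ _ (m<n⇒m%n≡m (toℕ<n a)) (m%n<n (toℕ a) n) (toℕ<n a)) (fromℕ<-toℕ a (toℕ<n a))

  %-cong-+ : ∀ {a b c d} → a % n ≡ b % n → c % n ≡ d % n → (a + c) % n ≡ (b + d) % n
  %-cong-+ {a} {b} {c} {d} = CommutativeMonoid.∙-cong (ℕ-mod n) {a} {b} {c} {d}

  %-cong-* : ∀ {a b c d} → a % n ≡ b % n → c % n ≡ d % n → (a * c) % n ≡ (b * d) % n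
  %-cong-* {a} {b} {c} {d} a≈b c≈d =
    ≡.trans (%-distribˡ-* a c n) (≡.trans (cong₂ (λ u v → (u * v) % n) a≈b c≈d) (≡.sym (%-distribˡ-* b d n)))

  mod-⊕ : ∀ a b → (a mod n) ⊕ (b mod n) ≡ (a + b) mod n
  mod-⊕ a b = mod-cong (%-cong-+ {toℕ (a mod n)} {a} {toℕ (b mod n)} {b} (toℕ-mod-% a) (toℕ-mod-% b))

  ·-mod : ∀ k a → k · (a mod n) ≡ (k * a) mod n
  ·-mod k a = mod-cong (%-cong-* {k} {k} {toℕ (a mod n)} {a} refl (toℕ-mod-% a))

  ⊕-comm : ∀ (a b : Fin n) → a ⊕ b ≡ b ⊕ a
  ⊕-comm a b = cong (_mod n) (ℕ.+-comm (toℕ a) (toℕ b))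

  ⊕-assoc : ∀ (a b c : Fin n) → (a ⊕ b) ⊕ c ≡ a ⊕ (b ⊕ c)
  ⊕-assoc a b c = begin
    (a ⊕ b) ⊕ c                       ≡⟨ cong ((a ⊕ b) ⊕_) (mod-toℕ c) ⟨
    (a ⊕ b) ⊕ (toℕ c mod n)           ≡⟨ mod-⊕ (toℕ a + toℕ b) (toℕ c) ⟩
    (toℕ a + toℕ b + toℕ c) mod n     ≡⟨ cong (_mod n) (ℕ.+-assoc (toℕ a) (toℕ b) (toℕ c)) ⟩
    (toℕ a + (toℕ b + toℕ c)) mod n   ≡⟨ mod-⊕ (toℕ a) (toℕ b + toℕ c) ⟨
    (toℕ a mod n) ⊕ (b ⊕ c)           ≡⟨ cong (_⊕ (b ⊕ c)) (mod-toℕ a) ⟩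
    a ⊕ (b ⊕ c)                       ∎
    where open ≡-Reasoning

  ⊕-identityʳ : ∀ (a : Fin n) → a ⊕ 𝟘 ≡ a
  ⊕-identityʳ a = begin
    a ⊕ 𝟘                ≡⟨ cong (_⊕ 𝟘) (mod-toℕ a) ⟨
    (toℕ a mod n) ⊕ 𝟘    ≡⟨ mod-⊕ (toℕ a) 0 ⟩
    (toℕ a + 0) mod n    ≡⟨ cong (_mod n) (ℕ.+-identityʳ (toℕ a)) ⟩
    toℕ a mod n          ≡⟨ mod-toℕ a ⟩
    a                    ∎
    where open ≡-Reasoning

  ⊖-⊕ : ∀ (a b : Fin n) → (a ⊖ b) ⊕ b ≡ a
  ⊖-⊕ a b = begin
    (a ⊖ b) ⊕ b                            ≡⟨ cong ((a ⊖ b) ⊕_) (mod-toℕ b) ⟨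
    (a ⊖ b) ⊕ (toℕ b mod n)                ≡⟨ mod-⊕ (toℕ a + (n ∸ toℕ b)) (toℕ b) ⟩
    (toℕ a + (n ∸ toℕ b) + toℕ b) mod n    ≡⟨ cong (_mod n) (ℕ.+-assoc (toℕ a) (n ∸ toℕ b) (toℕ b)) ⟩
    (toℕ a + (n ∸ toℕ b + toℕ b)) mod n    ≡⟨ cong (λ m → (toℕ a + m) mod n) (ℕ.m∸n+n≡m (ℕ.<⇒≤ (toℕ<n b))) ⟩
    (toℕ a + n) mod n                      ≡⟨ mod-cong ([m+n]%n≡m%n (toℕ a) n) ⟩
    toℕ a mod n                            ≡⟨ mod-toℕ a ⟩
    a                                      ∎
    where open ≡-Reasoning

  ⊕-cancelʳ : ∀ (c : Fin n) {a b} → a ⊕ c ≡ b ⊕ c → a ≡ b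
  ⊕-cancelʳ c {a} {b} eq = ≡.trans (≡.sym (undo a)) (≡.trans (cong (_⊕ (𝟘 ⊖ c)) eq) (undo b))
    where
    undo : ∀ a → (a ⊕ c) ⊕ (𝟘 ⊖ c) ≡ a
    undo a = ≡.trans (⊕-assoc a c _)
      (≡.trans (cong (a ⊕_) (≡.trans (⊕-comm c _) (⊖-⊕ 𝟘 c))) (⊕-identityʳ a))

  ⊕-⊖ : ∀ (a b : Fin n) → (a ⊕ b) ⊖ b ≡ a
  ⊕-⊖ a b = ⊕-cancelʳ b (⊖-⊕ (a ⊕ b) b)

  ⊖-identityʳ : ∀ (a : Fin n) → a ⊖ 𝟘 ≡ a
  ⊖-identityʳ a = ≡.trans (≡.sym (⊕-identityʳ _)) (⊖-⊕ a 𝟘)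

  ·-cong : ∀ {k l} → k % n ≡ l % n → (a : Fin n) → k · a ≡ l · a
  ·-cong {k} {l} k≈l a = mod-cong (%-cong-* {k} {l} {toℕ a} {toℕ a} k≈l refl)

  ·-distribˡ-⊕ : ∀ k (a b : Fin n) → k · (a ⊕ b) ≡ (k · a) ⊕ (k · b)
  ·-distribˡ-⊕ k a b = begin
    k · (a ⊕ b)                          ≡⟨ ·-mod k (toℕ a + toℕ b) ⟩
    (k * (toℕ a + toℕ b)) mod n          ≡⟨ cong (_mod n) (ℕ.*-distribˡ-+ k (toℕ a) (toℕ b)) ⟩
    (k * toℕ a + k * toℕ b) mod n        ≡⟨ mod-⊕ (k * toℕ a) (k * toℕ b) ⟨
    (k · a) ⊕ (k · b)                    ∎
    where open ≡-Reasoning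

  ·-· : ∀ k l (a : Fin n) → k · (l · a) ≡ (k * l) · a
  ·-· k l a = ≡.trans (·-mod k (l * toℕ a)) (cong (_mod n) (≡.sym (ℕ.*-assoc k l (toℕ a))))

  1-· : ∀ (a : Fin n) → 1 · a ≡ a
  1-· a = ≡.trans (cong (_mod n) (ℕ.*-identityˡ (toℕ a))) (mod-toℕ a)

  suc-· : ∀ k (a : Fin n) → suc k · a ≡ a ⊕ (k · a)
  suc-· k a = ≡.trans (≡.sym (mod-⊕ (toℕ a) (k * toℕ a))) (cong (_⊕ (k · a)) (mod-toℕ a))

  ·-zeroʳ : ∀ k → k · 𝟘 ≡ 𝟘
  ·-zeroʳ k = ≡.trans (·-mod k 0) (cong (_mod n) (ℕ.*-zeroʳ k))

  -- The right side is `1 % n` and not 1, so that n = 1 is covered.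
  Inverse : ℕ → ℕ → Set
  Inverse l k = (l * k) % n ≡ 1 % n

  Inverse-sym : ∀ l k → Inverse l k → Inverse k l
  Inverse-sym l k = ≡.trans (cong (_% n) (ℕ.*-comm k l))

  ·-cancel : ∀ l k → Inverse l k → (a : Fin n) → l · (k · a) ≡ a
  ·-cancel l k inv a = ≡.trans (·-· l k a) (≡.trans (·-cong inv a) (1-· a))

  scale : ∀ l k → Inverse l k → Permutation′ n
  scale l k inv = permutation (k ·_) (l ·_) (·-cancel k l (Inverse-sym l k inv)) (·-cancel l k inv)

  translate : Fin n → Permutation′ n
  translate a = permutation (_⊕ a) (_⊖ a) (λ b → ⊖-⊕ b a) (λ b → ⊕-⊖ b a)

  -- Adjacency operators modulo p, and prime multipliers.

  -- Says that φ is an automorphism of Circ(n, T). The connection set is a Boolean function, so that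
  -- scaling it is precomposition and its values can be read as entries 0 and 1.
  Invariant : Permutation′ n → (Fin n → Bool) → Set
  Invariant φ T = ∀ v w → T (w ⊖ v) ≡ T ((φ ⟨$⟩ʳ w) ⊖ (φ ⟨$⟩ʳ v))

  module Adjacency (p : ℕ) (p-prime : Prime p) where

    instance
      p≢0 : NonZero p
      p≢0 = prime⇒nonZero p-prime

    functions : CommutativeMonoid 0ℓ 0ℓ
    functions = Pointwise.commutativeMonoid (Fin n) (ℕ-mod p)

    open Endomorphism functions
    open Semiring semiring using (_≈_)
    open Frobenius semiring p p-prime using (0^≈0; sum-^; ^-comm)
    open Exp semiring using (_^_)
    open Mult semiring using () renaming (_×_ to _×ₙ_)
    module E = Semiring semiring
    module ∑E = SemiringSum semiring
    module N = CommutativeMonoid (ℕ-mod p)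
    module ∑N = CommutativeMonoidSum (ℕ-mod p)

    ×-⟦⟧ : ∀ k a f x → ⟦ k ×ₙ a ⟧ f x ≡ k * ⟦ a ⟧ f x
    ×-⟦⟧ zero    a f x = refl
    ×-⟦⟧ (suc k) a f x = cong (⟦ a ⟧ f x +_) (×-⟦⟧ k a f x)

    sum-⟦⟧ : ∀ {m} (as : Fin m → Endo) f x → ⟦ ∑E.sum as ⟧ f x ≡ ∑N.sum (λ i → ⟦ as i ⟧ f x)
    sum-⟦⟧ {zero}  as f x = refl
    sum-⟦⟧ {suc m} as f x = cong (⟦ as zero ⟧ f x +_) (sum-⟦⟧ (as ∘ suc) f x)

    characteristic : ∀ a → p ×ₙ a ≈ 0ₑ
    characteristic a f x = begin
      ⟦ p ×ₙ a ⟧ f x % p     ≡⟨ cong (_% p) (×-⟦⟧ p a f x) ⟩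
      (p * ⟦ a ⟧ f x) % p    ≡⟨ cong (_% p) (ℕ.*-comm p (⟦ a ⟧ f x)) ⟩
      (⟦ a ⟧ f x * p) % p    ≡⟨ m*n%n≡0 (⟦ a ⟧ f x) p ⟩
      0                      ≡⟨ m*n%n≡0 0 p ⟨
      0 % p                  ∎
      where open ≡-Reasoning

    pullback : (Fin n → Fin n) → Endo
    pullback φ = record
      { ⟦_⟧     = _∘ φ
      ; ⟦⟧-cong = λ f≈g x → f≈g (φ x)
      ; ∙-homo  = λ _ _ _ → refl
      ; ε-homo  = λ _ → refl
      }

    shift : Fin n → Endo
    shift a = pullback (_⊕ a)

    shift-cong : ∀ {a b} → a ≡ b → shift a ≈ shift b
    shift-cong refl _ _ = refl

    shift-comm : ∀ a b → shift a ⊠ shift b ≈ shift b ⊠ shift a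
    shift-comm a b f x = cong (λ y → f y % p)
      (≡.trans (⊕-assoc x a b) (≡.trans (cong (x ⊕_) (⊕-comm a b)) (≡.sym (⊕-assoc x b a))))

    shift-^ : ∀ a k → shift a ^ k ≈ shift (k · a)
    shift-^ a zero    f x = cong (λ y → f y % p) (≡.sym (⊕-identityʳ x))
    shift-^ a (suc k) f x = ≡.trans (shift-^ a k f (x ⊕ a))
      (cong (λ y → f y % p) (≡.trans (⊕-assoc x a (k · a)) (cong (x ⊕_) (≡.sym (suc-· k a)))))

    -- The sum over T runs over all of ℤ_n with zero terms outside T, so that it can be reindexed by
    -- permutations of ℤ_n.
    term : (Fin n → Bool) → Fin n → Endo
    term T s = if T s then shift s else 0ₑ

    adjacency : (Fin n → Bool) → Endo
    adjacency T = ∑E.sum (term T)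

    term-comm : ∀ T s t → term T s ⊠ term T t ≈ term T t ⊠ term T s
    term-comm T s t with T s | T t
    ... | true  | true  = shift-comm s t
    ... | true  | false = λ _ _ → refl
    ... | false | true  = λ _ _ → refl
    ... | false | false = λ _ _ → refl

    term-^ : ∀ T s → term T s ^ p ≈ (if T s then shift (p · s) else 0ₑ)
    term-^ T s with T s
    ... | true  = shift-^ s p
    ... | false = 0^≈0 p

    -- With q inverse to p modulo n, T ∘ (q ·_) is the characteristic function of pT.
    adjacency-frobenius : ∀ T q → Inverse q p → adjacency T ^ p ≈ adjacency (T ∘ (q ·_))
    adjacency-frobenius T q inv = begin
      adjacency T ^ p                  ≈⟨ sum-^ characteristic (term T) (term-comm T) ⟩
      ∑E.sum (λ s → term T s ^ p)      ≈⟨ ∑E.sum-cong-≋ (term-^ T) ⟩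
      -- Since `q` is a unit, `q ·_` permutes the indices, and the shift by `p · (q · s)` becomes
      -- the shift by `s`.
      ∑E.sum g                         ≈⟨ ∑E.sum-permute g (scale p q (Inverse-sym q p inv)) ⟩
      ∑E.sum (λ s → g (q · s))         ≈⟨ ∑E.sum-cong-≋ rescale ⟩
      adjacency (T ∘ (q ·_))           ∎
      where
      open SetoidReasoning E.setoid
      g : Fin n → Endo
      g s = if T s then shift (p · s) else 0ₑ
      rescale : ∀ s → g (q · s) ≈ term (T ∘ (q ·_)) s
      rescale s with T (q · s)
      ... | true  = shift-cong (·-cancel p q (Inverse-sym q p inv) s)
      ... | false = λ _ _ → refl

    -- Matrix form of the operator: the substitution w = s + x turns the sum of translates into row
    -- x of the adjacency matrix applied to f.
    adjacency-⟦⟧ : ∀ T f x → ⟦ adjacency T ⟧ f x N.≈ ∑N.sum (λ w → if T (w ⊖ x) then f w else 0)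
    adjacency-⟦⟧ T f x = begin
      ⟦ adjacency T ⟧ f x                     ≡⟨ sum-⟦⟧ (term T) f x ⟩
      ∑N.sum (λ s → ⟦ term T s ⟧ f x)         ≡⟨ ∑N.sum-cong-≗ entry ⟩
      ∑N.sum (λ s → g (s ⊕ x))                ≈⟨ ∑N.sum-permute g (translate x) ⟨
      ∑N.sum g                                ∎
      where
      open SetoidReasoning N.setoid
      g : Fin n → ℕ
      g w = if T (w ⊖ x) then f w else 0
      entry : ∀ s → ⟦ term T s ⟧ f x ≡ g (s ⊕ x)
      entry s rewrite ⊕-⊖ s x with T s
      ... | true  = cong f (⊕-comm x s)
      ... | false = refl

    -- Row φ(x) is reindexed along φ, and invariance identifies its entries with those of row x.
    adjacency-equivariant : ∀ φ T → Invariant φ T →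
      pullback (φ ⟨$⟩ʳ_) ⊠ adjacency T ≈ adjacency T ⊠ pullback (φ ⟨$⟩ʳ_)
    adjacency-equivariant φ T inv f x = begin
      ⟦ adjacency T ⟧ f (φ ⟨$⟩ʳ x)           ≈⟨ adjacency-⟦⟧ T f (φ ⟨$⟩ʳ x) ⟩
      ∑N.sum g                               ≈⟨ ∑N.sum-permute g φ ⟩
      ∑N.sum (λ w → g (φ ⟨$⟩ʳ w))            ≡⟨ ∑N.sum-cong-≗ (λ w → cong (if_then f (φ ⟨$⟩ʳ w) else 0) (inv x w)) ⟨
      ∑N.sum (λ w → if T (w ⊖ x) then f (φ ⟨$⟩ʳ w) else 0)
                                             ≈⟨ adjacency-⟦⟧ T (f ∘ (φ ⟨$⟩ʳ_)) x ⟨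
      ⟦ adjacency T ⟧ (f ∘ (φ ⟨$⟩ʳ_)) x      ∎
      where
      open SetoidReasoning N.setoid
      g : Fin n → ℕ
      g w = if T (w ⊖ (φ ⟨$⟩ʳ x)) then f w else 0

    -- Commutation with an operator passes to its p-th power, which Frobenius identifies with the
    -- adjacency operator of the scaled set.
    scaled-adjacency-equivariant : ∀ φ T q → Inverse q p → Invariant φ T →
      pullback (φ ⟨$⟩ʳ_) ⊠ adjacency (T ∘ (q ·_)) ≈ adjacency (T ∘ (q ·_)) ⊠ pullback (φ ⟨$⟩ʳ_)
    scaled-adjacency-equivariant φ T q inv T-inv = begin
      Φ ⊠ A′           ≈⟨ E.*-congˡ {Φ} {A ^ p} {A′} frobenius ⟨
      Φ ⊠ A ^ p        ≈⟨ ^-comm {Φ} {A} (adjacency-equivariant φ T T-inv) p ⟩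
      A ^ p ⊠ Φ        ≈⟨ E.*-congʳ {Φ} {A ^ p} {A′} frobenius ⟩
      A′ ⊠ Φ           ∎
      where
      open SetoidReasoning E.setoid
      Φ  = pullback (φ ⟨$⟩ʳ_)
      A  = adjacency T
      A′ = adjacency (T ∘ (q ·_))
      frobenius : A ^ p ≈ A′
      frobenius = adjacency-frobenius T q inv

    sum-single : ∀ {m} (g : Fin m → ℕ) i → (∀ j → j ≢ i → g j ≡ 0) → ∑N.sum g N.≈ g i
    sum-single {suc m} g i g≡0 = begin
      ∑N.sum g                                   ≈⟨ ∑N.sum-remove {i = i} g ⟩
      g i + ∑N.sum (removeAt g i)                ≡⟨ cong (g i +_) (∑N.sum-cong-≗ (λ j → g≡0 _ (punchInᵢ≢i i j))) ⟩
      g i + ∑N.sum (replicate m 0)               ≈⟨ N.∙-congˡ {g i} (∑N.sum-replicate-zero m) ⟩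
      g i + 0                                    ≡⟨ ℕ.+-identityʳ (g i) ⟩
      g i                                        ∎
      where open SetoidReasoning N.setoid

    indicator : Bool → ℕ
    indicator b = if b then 1 else 0

    -- A prime exceeds 1, so 0 and 1 stay distinct modulo `p`.
    indicator-injective : ∀ a b → indicator a N.≈ indicator b → a ≡ b
    indicator-injective true  true  eq = refl
    indicator-injective false false eq = refl
    indicator-injective true  false eq = contradiction eq 1≉0
      where
      1≉0 : 1 % p ≢ 0 % p
      1≉0 eq with () ← ≡.trans (≡.sym (m<n⇒m%n≡m (ℕ.nonTrivial⇒n>1 p {{prime⇒nonTrivial p-prime}}))) (≡.trans eq (m*n%n≡0 0 p))
    indicator-injective false true  eq = ≡.sym (indicator-injective true false (≡.sym eq))

    -- Reads off a single matrix entry. The point mass at y is described by its values, so that the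
    -- composite of a point mass with a permutation also qualifies.
    adjacency-δ : ∀ T (f : Fin n → ℕ) x y → f y ≡ 1 → (∀ w → w ≢ y → f w ≡ 0) →
                  ⟦ adjacency T ⟧ f x N.≈ indicator (T (y ⊖ x))
    adjacency-δ T f x y fy≡1 f≡0 = begin
      ⟦ adjacency T ⟧ f x    ≈⟨ adjacency-⟦⟧ T f x ⟩
      ∑N.sum g               ≈⟨ sum-single g y g≡0 ⟩
      g y                    ≡⟨ cong (if T (y ⊖ x) then_else 0) fy≡1 ⟩
      indicator (T (y ⊖ x))  ∎
      where
      open SetoidReasoning N.setoid
      g : Fin n → ℕ
      g w = if T (w ⊖ x) then f w else 0
      g≡0 : ∀ w → w ≢ y → g w ≡ 0
      g≡0 w w≢y with T (w ⊖ x)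
      ... | true  = f≡0 w w≢y
      ... | false = refl

    -- The commutation relation is applied to the point mass δ at φ(w) and evaluated at v. One side
    -- gives the entry at (φ(v), φ(w)); on the other, δ ∘ φ is the point mass at w, which gives the
    -- entry at (v, w).
    invariant-prime : ∀ φ T q → Inverse q p → Invariant φ T → Invariant φ (T ∘ (q ·_))
    invariant-prime φ T q inv T-inv v w = indicator-injective _ _ (begin
      indicator (T′ (w ⊖ v))
        ≈⟨ adjacency-δ T′ (δ ∘ (φ ⟨$⟩ʳ_)) v w δ₁ (λ u u≢w → δ₀ (φ ⟨$⟩ʳ u) (u≢w ∘ φ-injective)) ⟨
      ⟦ adjacency T′ ⟧ (δ ∘ (φ ⟨$⟩ʳ_)) v
        ≈⟨ scaled-adjacency-equivariant φ T q inv T-inv δ v ⟨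
      ⟦ adjacency T′ ⟧ δ (φ ⟨$⟩ʳ v)
        ≈⟨ adjacency-δ T′ δ (φ ⟨$⟩ʳ v) (φ ⟨$⟩ʳ w) δ₁ δ₀ ⟩
      indicator (T′ ((φ ⟨$⟩ʳ w) ⊖ (φ ⟨$⟩ʳ v))) ∎)
      where
      open SetoidReasoning N.setoid
      T′ : Fin n → Bool
      T′ = T ∘ (q ·_)
      δ : Fin n → ℕ
      δ u = indicator (does (u ≟ (φ ⟨$⟩ʳ w)))
      δ₁ : δ (φ ⟨$⟩ʳ w) ≡ 1
      δ₁ = cong indicator (dec-true ((φ ⟨$⟩ʳ w) ≟ _) refl)
      δ₀ : ∀ u → u ≢ φ ⟨$⟩ʳ w → δ u ≡ 0
      δ₀ u u≢ = cong indicator (dec-false (u ≟ _) u≢)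
      φ-injective : ∀ {u} → φ ⟨$⟩ʳ u ≡ φ ⟨$⟩ʳ w → u ≡ w
      φ-injective eq = ≡.trans (≡.sym (inverseˡ φ)) (≡.trans (cong (φ ⟨$⟩ˡ_) eq) (inverseˡ φ))

  -- From prime multipliers to arbitrary units.

  -- If `l` inverts p q, then `l * q` inverts p and `l * p` inverts q. Scaling by the first handles
  -- the prime p, induction handles q, and the two scalings compose to scaling by `l` because l p q
  -- ≡ 1.
  invariant-product : ∀ φ T ps l → All Prime ps → Inverse l (product ps) → Invariant φ T → Invariant φ (T ∘ (l ·_))
  invariant-product φ T [] l [] inv T-inv v w =
    ≡.trans (cong T (l·≡id (w ⊖ v))) (≡.trans (T-inv v w) (cong T (≡.sym (l·≡id _))))
    where
    l·≡id : ∀ a → l · a ≡ a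
    l·≡id a = ≡.trans (cong (l ·_) (≡.sym (1-· a))) (·-cancel l 1 inv a)
  invariant-product φ T (p ∷ ps) l (p-prime ∷ ps-prime) inv T-inv v w =
    ≡.trans (cong T (≡.sym (factor (w ⊖ v)))) (≡.trans (step v w) (cong T (factor _)))
    where
    q = product ps
    q⁻¹ : Inverse (l * p) q
    q⁻¹ = ≡.trans (cong (_% n) (ℕ.*-assoc l p q)) inv
    p⁻¹ : Inverse (l * q) p
    p⁻¹ = ≡.trans (cong (_% n) (≡.trans (ℕ.*-assoc l q p) (cong (l *_) (ℕ.*-comm q p)))) inv
    step : Invariant φ (λ a → T ((l * q) · ((l * p) · a)))
    step = invariant-product φ (T ∘ ((l * q) ·_)) ps (l * p) ps-prime q⁻¹
      (Adjacency.invariant-prime p p-prime φ T (l * q) p⁻¹ T-inv)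
    factor : ∀ a → (l * q) · ((l * p) · a) ≡ l · a
    factor a = begin
      (l * q) · ((l * p) · a)  ≡⟨ ·-· (l * q) (l * p) a ⟩
      (l * q * (l * p)) · a    ≡⟨ cong (_· a) (rearrange l p q) ⟩
      (l * (p * q) * l) · a    ≡⟨ ·-· (l * (p * q)) l a ⟨
      (l * (p * q)) · (l · a)  ≡⟨ ·-cong inv (l · a) ⟩
      1 · (l · a)              ≡⟨ 1-· (l · a) ⟩
      l · a                    ∎
      where
      open ≡-Reasoning
      rearrange : ∀ l p q → l * q * (l * p) ≡ l * (p * q) * l
      rearrange = solve-∀

  -- m is replaced by m + n, which is positive and hence has a prime factorisation.
  invariant-unit : ∀ φ T l m → Inverse l m → Invariant φ T → Invariant φ (T ∘ (l ·_))
  invariant-unit φ T l m inv = invariant-product φ T (factors F) l (factorsPrime F)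
    (≡.trans (cong (λ k → (l * k) % n) (≡.sym (isFactorisation F)))
      (≡.trans (%-cong-* {l} {l} {m + n} {m} refl ([m+n]%n≡m%n m n)) inv))
    where
    open PrimeFactorisation
    F : PrimeFactorisation (m + n)
    F = factorise (m + n) {{ℕ.>-nonZero (ℕ.<-≤-trans (ℕ.>-nonZero⁻¹ n) (ℕ.m≤n+m n m))}}

  -- Multipliers of arc-transitive circulants.

  aut⇒invariant : ∀ S φ → IsDigraphAut S φ → Invariant φ (lookup S)
  aut⇒invariant S φ aut v w = ⇔⇒≡ (aut v w)
    where
    ⇔⇒≡ : ∀ {x y} → x ∈ S ⇔ y ∈ S → lookup S x ≡ lookup S y
    ⇔⇒≡ {x} {y} x⇔y with lookup S x in eqx | lookup S y in eqy
    ... | true  | true  = refl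
    ... | false | false = refl
    ... | true  | false = ≡.trans (≡.sym ([]=⇒lookup (Equivalence.to x⇔y (lookup⇒[]= x S eqx)))) eqy
    ... | false | true  = ≡.trans (≡.sym eqx) ([]=⇒lookup (Equivalence.from x⇔y (lookup⇒[]= y S eqy)))

  -- Arc-transitivity gives an automorphism φ that fixes `𝟘` and sends t to x. It also preserves
  -- Circ(n, mS), so x lies in mS because t does; membership of a in mS is expressed as `l · a ∈ S`.
  multiplier : ∀ S → ArcTransitive S → ∀ l m → Inverse l m → ∀ t → t ∈ S → l · t ∈ S → ∀ x → x ∈ S → l · x ∈ S
  multiplier S arc-trans l m inv t t∈S lt∈S x x∈S
    with φ , aut , φ0 , φt ← arc-trans 𝟘 t 𝟘 x (subst (_∈ S) (≡.sym (⊖-identityʳ t)) t∈S)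
                                               (subst (_∈ S) (≡.sym (⊖-identityʳ x)) x∈S)
    = lookup⇒[]= (l · x) S (begin
      lookup S (l · x)                                       ≡⟨ cong T′ (⊖-identityʳ x) ⟨
      lookup S (l · (x ⊖ 𝟘))                                 ≡⟨ cong₂ (λ a b → T′ (a ⊖ b)) φt φ0 ⟨
      lookup S (l · ((φ ⟨$⟩ʳ t) ⊖ (φ ⟨$⟩ʳ 𝟘)))               ≡⟨ invariant-unit φ (lookup S) l m inv (aut⇒invariant S φ aut) 𝟘 t ⟨
      lookup S (l · (t ⊖ 𝟘))                                 ≡⟨ cong T′ (⊖-identityʳ t) ⟩
      lookup S (l · t)                                       ≡⟨ []=⇒lookup lt∈S ⟩
      true                                                   ∎)
    where
    open ≡-Reasoning
    T′ : Fin n → Bool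
    T′ a = lookup S (l · a)

  -- Generators as units, and normality from generators.

  -- For a common divisor d, the multiple (n/d) s is divisible by n, so minimality of the order
  -- gives n ≤ n/d and hence d ≤ 1.
  order⇒coprime : ∀ {s : Fin n} → HasOrder s n → Coprime (toℕ s) n
  order⇒coprime {s} (0<n , _ , minimal) {d} (divides r s≡r*d , divides q n≡q*d) = ℕ.≤-antisym d≤1 1≤d
    where
    open ≡-Reasoning
    q*d≢0 : NonZero (q * d)
    q*d≢0 = subst NonZero n≡q*d (ℕ.>-nonZero 0<n)
    0<q : 0 < q
    0<q = ℕ.>-nonZero⁻¹ q {{ℕ.m*n≢0⇒m≢0 q {{q*d≢0}}}}
    1≤d : 1 ≤ d
    1≤d = ℕ.>-nonZero⁻¹ d {{ℕ.m*n≢0⇒n≢0 q {{q*d≢0}}}}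
    q·s≡0 : q · s ≡ 𝟘
    q·s≡0 = mod-cong (begin
      (q * toℕ s) % n    ≡⟨ cong (λ a → (q * a) % n) s≡r*d ⟩
      (q * (r * d)) % n  ≡⟨ cong (_% n) (rearrange q r d) ⟩
      (r * (q * d)) % n  ≡⟨ cong (λ a → (r * a) % n) n≡q*d ⟨
      (r * n) % n        ≡⟨ m*n%n≡0 r n ⟩
      0                  ≡⟨ m*n%n≡0 0 n ⟨
      0 % n              ∎)
      where
      rearrange : ∀ q r d → q * (r * d) ≡ r * (q * d)
      rearrange = solve-∀
    d≤1 : d ≤ 1
    d≤1 = ℕ.*-cancelˡ-≤ q {{ℕ.>-nonZero 0<q}}
      (ℕ.≤-trans (ℕ.≤-reflexive (≡.sym n≡q*d)) (ℕ.≤-trans (minimal q 0<q q·s≡0) (ℕ.≤-reflexive (≡.sym (ℕ.*-identityʳ q)))))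

  -- Bézout's identity over ℕ has two forms, according to which product exceeds the other by 1; in
  -- the first, the coefficient of `a` is the inverse.
  coprime⇒inverse : ∀ a → Coprime a n → ∃ λ u → Inverse u a
  coprime⇒inverse a cop with coprime-Bézout cop
  ... | Bézout.+- x y eq = x , ≡.trans (cong (_% n) (≡.sym eq)) ([m+kn]%n≡m%n 1 y n)
  -- Here 1 + x a ≡ 0, so x (x a) is an inverse: x a x a ≡ (-1)².
  ... | Bézout.-+ x y eq = x * (x * a) , (begin
    (x * (x * a) * a) % n                  ≡⟨ [m+kn]%n≡m%n (x * (x * a) * a) y n ⟨
    (x * (x * a) * a + y * n) % n          ≡⟨ cong (λ b → (x * (x * a) * a + b) % n) eq ⟨
    (x * (x * a) * a + (1 + x * a)) % n    ≡⟨ cong (_% n) (rearrange x a) ⟩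
    (1 + x * a * (1 + x * a)) % n          ≡⟨ cong (λ b → (1 + x * a * b) % n) eq ⟩
    (1 + x * a * (y * n)) % n              ≡⟨ cong (λ b → (1 + b) % n) (ℕ.*-assoc (x * a) y n) ⟨
    (1 + x * a * y * n) % n                ≡⟨ [m+kn]%n≡m%n 1 (x * a * y) n ⟩
    1 % n                                  ∎)
    where
    open ≡-Reasoning
    rearrange : ∀ x a → x * (x * a) * a + (1 + x * a) ≡ 1 + x * a * (1 + x * a)
    rearrange = solve-∀

  ratio : ∀ s t u v → Inverse u s → Inverse v t → Inverse (s * v) (t * u)
  ratio s t u v us vt = ≡.trans (cong (_% n) (rearrange s t u v)) (%-cong-* {u * s} {1} {v * t} {1} us vt)
    where
    rearrange : ∀ s t u v → s * v * (t * u) ≡ u * s * (v * t)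
    rearrange = solve-∀

  ratio-· : ∀ (s t : Fin n) u → Inverse u (toℕ s) → (toℕ t * u) · s ≡ t
  ratio-· s t u us = begin
    (toℕ t * u) · s            ≡⟨ cong (_mod n) (ℕ.*-assoc (toℕ t) u (toℕ s)) ⟩
    (toℕ t * (u * toℕ s)) mod n  ≡⟨ mod-cong (%-cong-* {toℕ t} {toℕ t} {u * toℕ s} {1} refl us) ⟩
    (toℕ t * 1) mod n          ≡⟨ cong (_mod n) (ℕ.*-identityʳ (toℕ t)) ⟩
    toℕ t mod n                ≡⟨ mod-toℕ t ⟩
    t                          ∎
    where open ≡-Reasoning

  -- The required automorphism is multiplication by t/s. Both t/s and s/t are multipliers of S, so
  -- membership in S is preserved and reflected.
  generators⇒normal : ∀ S → ArcTransitive S → (∀ s → s ∈ S → HasOrder s n) → NormalArcTransitive S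
  generators⇒normal S arc-trans gen s t s∈S t∈S
    with u , us ← coprime⇒inverse (toℕ s) (order⇒coprime (gen s s∈S))
       | v , vt ← coprime⇒inverse (toℕ t) (order⇒coprime (gen t t∈S))
    = scale l m l⁻¹ , (·-distribˡ-⊕ m , λ x → mk⇔ (m-stable x) (m-reflects x)) , ms≡t
    where
    -- `u` and `v` invert s and t, so `m` represents t/s and `l` represents s/t.
    m = toℕ t * u
    l = toℕ s * v
    l⁻¹ : Inverse l m
    l⁻¹ = ratio (toℕ s) (toℕ t) u v us vt
    ms≡t : m · s ≡ t
    ms≡t = ratio-· s t u us
    l-stable : ∀ x → x ∈ S → l · x ∈ S
    l-stable = multiplier S arc-trans l m l⁻¹ t t∈S (subst (_∈ S) (≡.sym (ratio-· t s v vt)) s∈S)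
    -- The roles of `l` and `m` are exchanged, with `s` as the base point, since m s = t lies in S.
    m-stable : ∀ x → x ∈ S → m · x ∈ S
    m-stable = multiplier S arc-trans m l (Inverse-sym l m l⁻¹) s s∈S (subst (_∈ S) (≡.sym ms≡t) t∈S)
    m-reflects : ∀ x → m · x ∈ S → x ∈ S
    m-reflects x mx∈S = subst (_∈ S) (·-cancel l m l⁻¹ x) (l-stable (m · x) mx∈S)

  -- Group automorphisms, and generators from normality.

  groupAut-𝟘 : ∀ σ → IsGroupAut σ → σ ⟨$⟩ʳ 𝟘 ≡ 𝟘
  groupAut-𝟘 σ hom = ⊕-cancelʳ (σ ⟨$⟩ʳ 𝟘) (begin
    (σ ⟨$⟩ʳ 𝟘) ⊕ (σ ⟨$⟩ʳ 𝟘)  ≡⟨ hom 𝟘 𝟘 ⟨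
    σ ⟨$⟩ʳ (𝟘 ⊕ 𝟘)           ≡⟨ cong (σ ⟨$⟩ʳ_) (⊕-identityʳ 𝟘) ⟩
    σ ⟨$⟩ʳ 𝟘                 ≡⟨ ⊕-identityʳ _ ⟨
    (σ ⟨$⟩ʳ 𝟘) ⊕ 𝟘           ≡⟨ ⊕-comm _ 𝟘 ⟩
    𝟘 ⊕ (σ ⟨$⟩ʳ 𝟘)           ∎)
    where open ≡-Reasoning

  groupAut-· : ∀ σ → IsGroupAut σ → ∀ k a → σ ⟨$⟩ʳ (k · a) ≡ k · (σ ⟨$⟩ʳ a)
  groupAut-· σ hom zero    a = groupAut-𝟘 σ hom
  groupAut-· σ hom (suc k) a = begin
    σ ⟨$⟩ʳ (suc k · a)                   ≡⟨ cong (σ ⟨$⟩ʳ_) (suc-· k a) ⟩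
    σ ⟨$⟩ʳ (a ⊕ (k · a))                 ≡⟨ hom a (k · a) ⟩
    (σ ⟨$⟩ʳ a) ⊕ (σ ⟨$⟩ʳ (k · a))        ≡⟨ cong ((σ ⟨$⟩ʳ a) ⊕_) (groupAut-· σ hom k a) ⟩
    (σ ⟨$⟩ʳ a) ⊕ (k · (σ ⟨$⟩ʳ a))        ≡⟨ suc-· k _ ⟨
    suc k · (σ ⟨$⟩ʳ a)                   ∎
    where open ≡-Reasoning

  -- Multiplication by `k` kills the difference along every arc, so it is constant on walks,
  -- whichever way their arcs are traversed.
  reach-annihilated : ∀ S k → (∀ s → s ∈ S → k · s ≡ 𝟘) → ∀ {w} → Reach S 𝟘 w → k · w ≡ 𝟘
  reach-annihilated S k kS≡0 = go
    where
    arc : ∀ v w → Arc S v w → k · w ≡ k · v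
    arc v w v→w = begin
      k · w                      ≡⟨ cong (k ·_) (⊖-⊕ w v) ⟨
      k · ((w ⊖ v) ⊕ v)          ≡⟨ ·-distribˡ-⊕ k (w ⊖ v) v ⟩
      (k · (w ⊖ v)) ⊕ (k · v)    ≡⟨ cong (_⊕ (k · v)) (kS≡0 _ v→w) ⟩
      𝟘 ⊕ (k · v)                ≡⟨ ⊕-comm 𝟘 _ ⟩
      (k · v) ⊕ 𝟘                ≡⟨ ⊕-identityʳ _ ⟩
      k · v                      ∎
      where open ≡-Reasoning
    go : ∀ {w} → Reach S 𝟘 w → k · w ≡ 𝟘
    go here                = ·-zeroʳ k
    go (fwd {u} {w} r u→w) = ≡.trans (arc u w u→w) (go r)
    go (bwd {u} {w} r w→u) = ≡.trans (≡.sym (arc w u w→u)) (go r)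

  -- An annihilator k of s annihilates 1, which is reached from `𝟘`. So n divides k, and n ≤ k when
  -- k is positive.
  normal⇒generators : ∀ S → Connected S → NormalArcTransitive S → ∀ s → s ∈ S → HasOrder s n
  normal⇒generators S conn normal s s∈S =
    ℕ.>-nonZero⁻¹ n , n·s≡0 , λ k 0<k ks≡0 → ∣⇒≤ {{ℕ.>-nonZero 0<k}} (annihilator k ks≡0)
    where
    open ≡-Reasoning
    n·s≡0 : n · s ≡ 𝟘
    n·s≡0 = mod-cong (≡.trans (cong (_% n) (ℕ.*-comm n (toℕ s))) (≡.trans (m*n%n≡0 (toℕ s) n) (≡.sym (m*n%n≡0 0 n))))
    annihilator : ∀ k → k · s ≡ 𝟘 → n ∣ k
    annihilator k ks≡0 = m%n≡0⇒n∣m k n (≡.trans (mod-injective k·1≡0) (m*n%n≡0 0 n))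
      where
      kS≡0 : ∀ t → t ∈ S → k · t ≡ 𝟘
      kS≡0 t t∈S with σ , (hom , _) , σs≡t ← normal s t s∈S t∈S = begin
        k · t             ≡⟨ cong (k ·_) σs≡t ⟨
        k · (σ ⟨$⟩ʳ s)    ≡⟨ groupAut-· σ hom k s ⟨
        σ ⟨$⟩ʳ (k · s)    ≡⟨ cong (σ ⟨$⟩ʳ_) ks≡0 ⟩
        σ ⟨$⟩ʳ 𝟘          ≡⟨ groupAut-𝟘 σ hom ⟩
        𝟘                 ∎
      k·1≡0 : k mod n ≡ 0 mod n
      k·1≡0 = begin
        k mod n           ≡⟨ cong (_mod n) (ℕ.*-identityʳ k) ⟨
        (k * 1) mod n     ≡⟨ ·-mod k 1 ⟨
        k · (1 mod n)     ≡⟨ reach-annihilated S k kS≡0 (conn 𝟘 (1 mod n)) ⟩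
        𝟘                 ∎

theorem1p1 : (n : ℕ) .{{_ : NonZero n}} (S : Subset n) →
    𝟘 ∉ S → Connected S → ArcTransitive S →
    NormalArcTransitive S ⇔ (∀ s → s ∈ S → HasOrder s n)
theorem1p1 n S _ conn arc-trans = mk⇔ (normal⇒generators S conn) (generators⇒normal S arc-trans)
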